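{- Let $F$ be a one-dimensional tropical fan in $\mathbb{R}^n$ whose rays span $\mathbb{R}^n$, and let $\pi:\mathbb{Z}^n\to\mathbb{Z}^k$ be a linear map such that $\pi_*(F)$ is a one-dimensional tropical fan. Call the set of rays of $F$ that are mapped by $\pi$ onto a ray of $\pi_*(F)$ the fibre of $\pi_*(F)$. If $\pi_*(F)$ is a one-dimensional Bergman fan in $\mathbb{R}^k$, then the fibre of $\pi_*(F)$ is contained in some gallery class of $F$.
   Context: A one-dimensional tropical fan $F$ in $\mathbb{R}^n$ consists of finitely many distinct rays $\mathbb{R}_+v_1,\dots,\mathbb{R}_+v_q$ (and the origin), with $v_i\in\mathbb{Z}^n$ primitive, together with positive integer weights $\omega_1,\dots,\omega_q$ satisfying the balancing condition $\sum_i\omega_iv_i=0$. The push-forward $\pi_*(F)$ under an integer linear map $\pi$ has as rays the half-lines spanned by the nonzero $\pi(v_i)$; the weight of the ray with primitive generator $u$ is $\sum\omega_im_i$, the sum over all $i$ with $\pi(v_i)=m_iu$, $m_i>0$. A one-dimensional Bergman fan in $\mathbb{R}^k$ ($k\ge1$) is the tropical fan with rays generated by $u_0,u_1,\dots,u_k$, all of weight $1$, where $u_1,\dots,u_k$ is a $\mathbb{Z}$-basis of $\mathbb{Z}^k$ and $u_0=-(u_1+\dots+u_k)$. For $l\in(\mathbb{Z}^n)^\vee$ put $\max(0,l)\cdot F=\sum_i\omega_i\max(0,l(v_i))$. If this equals $1$, the gallery of $F$ over $\max(0,l)$ is the set of rays $\mathbb{R}_+v_i$ of $F$ with $|l(v_i)|=1$;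 it always consists of exactly two rays. The relation on rays "equal, or together forming a gallery of $F$" is an equivalence relation; its equivalence classes are called gallery classes here. -}

module Defs where

open import Level using (0ℓ)
open import Data.Nat as ℕ using (ℕ; suc)
import Data.Nat.Properties as ℕ
open import Data.Integer as ℤ using (ℤ; +_; 0ℤ; 1ℤ; ∣_∣; _⊔_)
import Data.Integer.Properties as ℤ
import Data.Integer.Divisibility as ℤ
open import Data.Rational as ℚ using (ℚ)
import Data.Rational.Properties as ℚ
open import Data.Fin using (Fin; zero; suc)
open import Data.Product using (∃; ∃-syntax; _×_)
open import Data.Sum using (_⊎_)
open import Data.Vec.Functional using (Vector)
open import Function using (_∘_)
open import Relation.Nullary using (¬_)
open import Relation.Unary using (Pred; _∪_; _≐_; ｛_｝)
open import Relation.Binary using (Rel)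
open import Relation.Binary.PropositionalEquality using (_≡_; _≗_)
open import Algebra.Module.Bundles.Raw using (RawLeftModule)
open import Algebra.Module.Construct.TensorUnit using (rawLeftModule)
open import Algebra.Module.Morphism.Structures
  using (module LeftModuleMorphisms)
import Algebra.Properties.Semiring.Sum ℕ.+-*-semiring as ℕΣ
import Algebra.Properties.Semiring.Sum ℤ.+-*-semiring as ℤΣ
import Algebra.Properties.CommutativeMonoid.Sum ℚ.+-0-commutativeMonoid as ℚΣ

ℤ^ : ℕ → RawLeftModule ℤ 0ℓ 0ℓ
ℤ^ n = record
  { Carrierᴹ = Vector ℤ n
  ; _≈ᴹ_     = _≗_
  ; _+ᴹ_     = λ x y c → x c ℤ.+ y c
  ; _*ₗ_     = λ a x c → a ℤ.* x c
  ; 0ᴹ       = λ _ → 0ℤ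
  ; -ᴹ_      = λ x c → ℤ.- x c
  }

ℤ¹ : RawLeftModule ℤ 0ℓ 0ℓ
ℤ¹ = rawLeftModule {R = ℤ.+-*-rawRing}

record _⊸_ (M N : RawLeftModule ℤ 0ℓ 0ℓ) : Set where
  field
    ⟦_⟧      : RawLeftModule.Carrierᴹ M → RawLeftModule.Carrierᴹ N
    isLinear : LeftModuleMorphisms.IsLeftModuleHomomorphism M N ⟦_⟧

open _⊸_ public using (⟦_⟧)

Dual : ℕ → Set
Dual n = ℤ^ n ⊸ ℤ¹

0ᵛ : ∀ {n} → Vector ℤ n
0ᵛ _ = 0ℤ

lincomb : ∀ {n m} → Vector ℤ m → Vector (Vector ℤ n) m → Vector ℤ n
lincomb c b j = ℤΣ.sum (λ i → c i ℤ.* b i j)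

record IsBasis {k} (b : Fin k → Vector ℤ k) : Set where
  field
    spanning    : ∀ x → ∃[ c ] lincomb c b ≗ x
    independent : ∀ c → lincomb c b ≗ 0ᵛ → c ≗ 0ᵛ

Primitive : ∀ {n} → Vector ℤ n → Set
Primitive x = ∀ (d : ℕ) → (∀ j → (+ d) ℤ.∣ x j) → d ≡ 1

infixr 7 _·_
_·_ : ∀ {n} → ℕ → Vector ℤ n → Vector ℤ n
(m · u) j = (+ m) ℤ.* u j

-- For primitive u, the nonzero integer points of the half-line ℝ₊u are
-- exactly the positive integer multiples of u; so x ∈ray u says that x
-- is nonzero and spans the same half-line as u.
infix 4 _∈ray_
_∈ray_ : ∀ {n} → Vector ℤ n → Vector ℤ n → Set
x ∈ray u = ∃[ m ] 0 ℕ.< m × x ≗ m · u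

-- The r-th ray is the half-line ℝ₊(v r), with weight ω r.
record TropicalFan (n : ℕ) : Set where
  field
    #rays     : ℕ
    #rays>0   : 0 ℕ.< #rays
    v         : Fin #rays → Vector ℤ n
    v-prim    : ∀ r → Primitive (v r)
    distinct  : ∀ r s → v r ∈ray v s → r ≡ s
    ω         : Fin #rays → ℕ
    ω>0       : ∀ r → 0 ℕ.< ω r
    balanced  : lincomb (+_ ∘ ω) v ≗ 0ᵛ

  Ray : Set
  Ray = Fin #rays

open TropicalFan using (Ray)

-- The v r are integral, so they span ℝⁿ over ℝ iff they span ℚⁿ over ℚ.
Spanning : ∀ {n} → TropicalFan n → Set
Spanning {n} F = ∀ (x : Vector ℚ n) →
  ∃ λ (c : Vector ℚ #rays) → ∀ j → ℚΣ.sum (λ r → c r ℚ.* (v r j ℚ./ 1)) ≡ x j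
  where open TropicalFan F

-- G is the push-forward π_*(F).  The number mult r s is m if
-- π(v r) = m u with m > 0, where u is the primitive generator of the ray s
-- of G, and 0 if there is no such m; since u ≠ 0, this determines mult.
record IsPushForward {n k} (π : ℤ^ n ⊸ ℤ^ k)
                     (F : TropicalFan n) (G : TropicalFan k) : Set where
  private
    module F = TropicalFan F
    module G = TropicalFan G
  field
    image-is-ray : ∀ r → ¬ (⟦ π ⟧ (F.v r) ≗ 0ᵛ) →
                   ∃[ s ] ⟦ π ⟧ (F.v r) ∈ray G.v s
    ray-is-image : ∀ s → ∃[ r ] ⟦ π ⟧ (F.v r) ∈ray G.v s
    mult         : Ray F → Ray G → ℕ
    mult-spec    : ∀ r s →
                   (0 ℕ.< mult r s × ⟦ π ⟧ (F.v r) ≗ mult r s · G.v s)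
                   ⊎ (mult r s ≡ 0 × ¬ (⟦ π ⟧ (F.v r) ∈ray G.v s))
    weight       : ∀ s → G.ω s ≡ ℕΣ.sum (λ r → F.ω r ℕ.* mult r s)

record IsBergman {k} (G : TropicalFan k) : Set where
  open TropicalFan G hiding (Ray)
  field
    k≥1       : 1 ℕ.≤ k
    u         : Fin (suc k) → Vector ℤ k
    basis     : IsBasis (u ∘ suc)
    u₀        : ∀ j → u zero j ≡ ℤ.- ℤΣ.sum (λ i → u (suc i) j)
    u-is-ray  : ∀ i → ∃[ s ] u i ∈ray v s
    ray-is-u  : ∀ s → ∃[ i ] u i ∈ray v s
    weight-1  : ∀ s → ω s ≡ 1

max[0,_]·_ : ∀ {n} → Dual n → TropicalFan n → ℤ
max[0, l ]· F = ℤΣ.sum (λ r → (+ ω r) ℤ.* (0ℤ ⊔ ⟦ l ⟧ (v r)))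
  where open TropicalFan F

Gallery : ∀ {n} (F : TropicalFan n) → Dual n → Pred (Ray F) 0ℓ
Gallery F l r = ∣ ⟦ l ⟧ (TropicalFan.v F r) ∣ ≡ 1

FormGallery : ∀ {n} (F : TropicalFan n) → Rel (Ray F) 0ℓ
FormGallery F r s =
  ∃[ l ] max[0, l ]· F ≡ 1ℤ × Gallery F l ≐ (｛ r ｝ ∪ ｛ s ｝)

GalleryRelated : ∀ {n} (F : TropicalFan n) → Rel (Ray F) 0ℓ
GalleryRelated F r s = r ≡ s ⊎ FormGallery F r s

GalleryClass : ∀ {n} (F : TropicalFan n) → Ray F → Pred (Ray F) 0ℓ
GalleryClass F r s = GalleryRelated F r s

Fibre : ∀ {n k} (π : ℤ^ n ⊸ ℤ^ k) (F : TropicalFan n) (G : TropicalFan k) →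
        Pred (Ray F) 0ℓ
Fibre π F G r = ∃[ s ] ⟦ π ⟧ (TropicalFan.v F r) ∈ray TropicalFan.v G s

{-# OPTIONS --safe #-}
-- Since every weight of the Bergman fan is 1, exactly one ray of F lies over
-- each ray uⱼ, it maps primitively, and all other rays of F are killed by π.
-- Let r₀ be the ray over u₀, and let uᵢ* be dual to the basis vector uᵢ.
-- As uᵢ*(u₀) = -1, the form uᵢ* ∘ π is 1 on the ray over uᵢ, -1 on r₀
-- and 0 on all the other rays, so these two rays form a gallery of F.
-- Hence the class of r₀ contains the fibre.
module Submission where

open import Defs
open import Algebra.Module.Morphism.Construct.Composition
  using (isLeftModuleHomomorphism)
open import Algebra.Module.Morphism.Structures
  using (module LeftModuleMorphisms)
open import Data.Bool using (if_then_else_)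
open import Data.Fin using (Fin; zero; suc; fromℕ<; _≟_)
open import Data.Fin.Properties using (all?)
open import Data.Integer as ℤ using (ℤ; +_; 0ℤ; 1ℤ; -1ℤ; ∣_∣; _⊔_)
import Data.Integer.Properties as ℤ
open import Data.Nat as ℕ using (ℕ; zero; suc; z≤n; s≤s)
import Data.Nat.Properties as ℕ
open import Data.Product using (∃-syntax; _×_; _,_; proj₁; proj₂)
open import Data.Sum using (_⊎_; inj₁; inj₂)
open import Data.Vec.Functional using (Vector)
open import Function using (_∘_)
open import Relation.Binary.PropositionalEquality
open import Relation.Nullary using (yes; no; does; contradiction)
open import Relation.Nullary.Decidable using (dec-true; dec-false)
open import Relation.Unary using (_⊆_; _∪_; ｛_｝)
import Algebra.Properties.Semiring.Sum ℕ.+-*-semiring as ℕΣ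
import Algebra.Properties.Semiring.Sum ℤ.+-*-semiring as ℤΣ

open ≡-Reasoning

pos-sum : ∀ {n} (f : Vector ℕ n) → ℤΣ.sum (+_ ∘ f) ≡ + ℕΣ.sum f
pos-sum {zero}  f = refl
pos-sum {suc n} f = cong (ℤ._+_ (+ f zero)) (pos-sum (f ∘ suc))

term≤sum : ∀ {n} (f : Vector ℕ n) i → f i ℕ.≤ ℕΣ.sum f
term≤sum f zero    = ℕ.m≤m+n _ _
term≤sum f (suc i) = ℕ.≤-trans (term≤sum (f ∘ suc) i) (ℕ.m≤n+m _ _)

sum≤1⇒positive-unique : ∀ {n} (f : Vector ℕ n) → ℕΣ.sum f ℕ.≤ 1 →
                        ∀ i j → 0 ℕ.< f i → 0 ℕ.< f j → i ≡ j
sum≤1⇒positive-unique f Σ≤1 zero zero _ _ = refl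
sum≤1⇒positive-unique f Σ≤1 zero (suc j) p q = contradiction
  (ℕ.≤-trans (ℕ.+-mono-≤ p (ℕ.≤-trans q (term≤sum (f ∘ suc) j))) Σ≤1)
  λ { (s≤s ()) }
sum≤1⇒positive-unique f Σ≤1 (suc i) zero p q =
  sym (sum≤1⇒positive-unique f Σ≤1 zero (suc i) q p)
sum≤1⇒positive-unique f Σ≤1 (suc i) (suc j) p q = cong suc
  (sum≤1⇒positive-unique (f ∘ suc) (ℕ.≤-trans (ℕ.m≤n+m _ _) Σ≤1) i j p q)

module _ {n m} (b : Fin m → Vector ℤ n) where

  lincomb-+ : ∀ c d →
    lincomb (λ i → c i ℤ.+ d i) b ≗ λ j → lincomb c b j ℤ.+ lincomb d b j
  lincomb-+ c d j = trans
    (ℤΣ.sum-cong-≗ λ i → ℤ.*-distribʳ-+ (b i j) (c i) (d i))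
    (ℤΣ.∑-distrib-+ (λ i → c i ℤ.* b i j) (λ i → d i ℤ.* b i j))

  lincomb-* : ∀ a c → lincomb (λ i → a ℤ.* c i) b ≗ λ j → a ℤ.* lincomb c b j
  lincomb-* a c j = trans
    (ℤΣ.sum-cong-≗ λ i → ℤ.*-assoc a (c i) (b i j))
    (sym (ℤΣ.*-distribˡ-sum a (λ i → c i ℤ.* b i j)))

unit : ∀ {n} → Fin n → Vector ℤ n
unit j i = if does (j ≟ i) then 1ℤ else 0ℤ

unit-≡ : ∀ {n} (i : Fin n) → unit i i ≡ 1ℤ
unit-≡ i = cong (if_then 1ℤ else 0ℤ) (dec-true (i ≟ i) refl)

unit-≢ : ∀ {n} {j i : Fin n} → j ≢ i → unit j i ≡ 0ℤ
unit-≢ {j = j} {i} j≢i = cong (if_then 1ℤ else 0ℤ) (dec-false (j ≟ i) j≢i)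

lincomb-0 : ∀ {n m} (b : Fin m → Vector ℤ n) → lincomb 0ᵛ b ≗ 0ᵛ
lincomb-0 {m = m} b j = ℤΣ.sum-replicate-zero m

lincomb-unit : ∀ {n m} (b : Fin m → Vector ℤ n) i → lincomb (unit i) b ≗ b i
lincomb-unit b zero j = trans
  (cong₂ ℤ._+_ (ℤ.*-identityˡ (b zero j)) (lincomb-0 (b ∘ suc) j))
  (ℤ.+-identityʳ (b zero j))
lincomb-unit b (suc i) j =
  trans (ℤ.+-identityˡ _) (lincomb-unit (b ∘ suc) i j)

module Coordinates {k} {b : Fin k → Vector ℤ k} (basis : IsBasis b) where
  open IsBasis basis

  coords : Vector ℤ k → Vector ℤ k
  coords x = proj₁ (spanning x)

  lincomb-coords : ∀ x → lincomb (coords x) b ≗ x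
  lincomb-coords x = proj₂ (spanning x)

  coords-unique : ∀ x c → lincomb c b ≗ x → coords x ≗ c
  coords-unique x c eq i = ℤ.i-j≡0⇒i≡j _ _ (trans
    (cong (ℤ._+_ (coords x i)) (sym (ℤ.-1*i≡-i (c i))))
    (independent (λ i → coords x i ℤ.+ -1ℤ ℤ.* c i) vanishes i))
    where
    vanishes : lincomb (λ i → coords x i ℤ.+ -1ℤ ℤ.* c i) b ≗ 0ᵛ
    vanishes j = begin
      lincomb (λ i → coords x i ℤ.+ -1ℤ ℤ.* c i) b j
        ≡⟨ lincomb-+ b (coords x) _ j ⟩
      lincomb (coords x) b j ℤ.+ lincomb (λ i → -1ℤ ℤ.* c i) b j
        ≡⟨ cong₂ ℤ._+_ (lincomb-coords x j)
             (trans (lincomb-* b -1ℤ c j) (ℤ.-1*i≡-i _)) ⟩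
      x j ℤ.- lincomb c b j
        ≡⟨ ℤ.i≡j⇒i-j≡0 (sym (eq j)) ⟩
      0ℤ ∎

  dual : Fin k → Dual k
  dual i = record
    { ⟦_⟧      = λ x → coords x i
    ; isLinear = record
      { +ᴹ-isGroupHomomorphism = record
        { isMonoidHomomorphism = record
          { isMagmaHomomorphism = record
            { isRelHomomorphism = record
              { cong = λ {x} {y} x≗y → coords-unique x (coords y)
                  (λ j → trans (lincomb-coords y j) (sym (x≗y j))) i }
            ; homo = λ x y → coords-unique _ (λ i → coords x i ℤ.+ coords y i) (λ j → trans
                (lincomb-+ b (coords x) (coords y) j)
                (cong₂ ℤ._+_ (lincomb-coords x j) (lincomb-coords y j))) i
            }
          ; ε-homo = coords-unique 0ᵛ 0ᵛ (lincomb-0 b) i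
          }
        ; ⁻¹-homo = λ x → trans
            (coords-unique _ (λ i → -1ℤ ℤ.* coords x i)
              (λ j → trans (scaled -1ℤ x j) (ℤ.-1*i≡-i (x j))) i)
            (ℤ.-1*i≡-i (coords x i))
        }
      ; *ₗ-homo = λ a x → coords-unique _ (λ i → a ℤ.* coords x i) (scaled a x) i
      }
    }
    where
    scaled : ∀ a x → lincomb (λ i → a ℤ.* coords x i) b ≗ λ j → a ℤ.* x j
    scaled a x j =
      trans (lincomb-* b a (coords x) j) (cong (ℤ._*_ a) (lincomb-coords x j))

_⊚_ : ∀ {n k} → Dual k → ℤ^ n ⊸ ℤ^ k → Dual n
l ⊚ π = record
  { ⟦_⟧      = ⟦ l ⟧ ∘ ⟦ π ⟧
  ; isLinear = isLeftModuleHomomorphism trans (_⊸_.isLinear π) (_⊸_.isLinear l)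
  }

1·-identity : ∀ {n} (x : Vector ℤ n) → 1 · x ≗ x
1·-identity x j = ℤ.*-identityˡ (x j)

≗⇒∈ray : ∀ {n} {x y : Vector ℤ n} → x ≗ y → x ∈ray y
≗⇒∈ray {y = y} x≗y =
  1 , s≤s z≤n , λ j → trans (x≗y j) (sym (1·-identity y j))

module BergmanRays {k} (G : TropicalFan k) (bergman : IsBergman G) where
  private module G = TropicalFan G
  open IsBergman bergman public
  open Coordinates basis public using (dual)
  open Coordinates basis using (coords-unique)

  module _ (i : Fin k) where
    open LeftModuleMorphisms.IsLeftModuleHomomorphism
      (_⊸_.isLinear (dual i)) public
      using () renaming (⟦⟧-cong to dual-cong; 0ᴹ-homo to dual-0; *ₗ-homo to dual-*)

  dual-u₀ : ∀ i → ⟦ dual i ⟧ (u zero) ≡ -1ℤ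
  dual-u₀ = coords-unique (u zero) (λ _ → -1ℤ) λ j → begin
    ℤΣ.sum (λ i → -1ℤ ℤ.* u (suc i) j) ≡⟨ ℤΣ.*-distribˡ-sum -1ℤ (λ i → u (suc i) j) ⟨
    -1ℤ ℤ.* ℤΣ.sum (λ i → u (suc i) j) ≡⟨ ℤ.-1*i≡-i _ ⟩
    ℤ.- ℤΣ.sum (λ i → u (suc i) j)     ≡⟨ u₀ j ⟨
    u zero j                           ∎

  dual-basis : ∀ i j → ⟦ dual i ⟧ (u (suc j)) ≡ unit j i
  dual-basis i j = coords-unique (u (suc j)) (unit j) (lincomb-unit (u ∘ suc) j) i

  dual-uᵢ : ∀ i → ⟦ dual i ⟧ (u (suc i)) ≡ 1ℤ
  dual-uᵢ i = trans (dual-basis i i) (unit-≡ i)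

  some-dual-is-unit : ∀ j → ∃[ i ] ∣ ⟦ dual i ⟧ (u j) ∣ ≡ 1
  some-dual-is-unit zero    = i , cong ∣_∣ (dual-u₀ i)
    where i = fromℕ< k≥1
  some-dual-is-unit (suc i) = i , cong ∣_∣ (dual-uᵢ i)

  ray≗u : ∀ {j s} → u j ∈ray G.v s → G.v s ≗ u j
  ray≗u {j} {s} (m , _ , eq) c = begin
    G.v s c       ≡⟨ 1·-identity (G.v s) c ⟨
    (1 · G.v s) c ≡⟨ cong (λ m → (m · G.v s) c) m≡1 ⟨
    (m · G.v s) c ≡⟨ eq c ⟨
    u j c         ∎
    where
    i = proj₁ (some-dual-is-unit j)
    m≡1 : m ≡ 1
    m≡1 = ℕ.m*n≡1⇒m≡1 m ∣ ⟦ dual i ⟧ (G.v s) ∣ (begin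
      m ℕ.* ∣ ⟦ dual i ⟧ (G.v s) ∣     ≡⟨ ℤ.abs-* (+ m) _ ⟨
      ∣ + m ℤ.* ⟦ dual i ⟧ (G.v s) ∣   ≡⟨ cong ∣_∣ (dual-* i (+ m) (G.v s)) ⟨
      ∣ ⟦ dual i ⟧ (m · G.v s) ∣       ≡⟨ cong ∣_∣ (dual-cong i eq) ⟨
      ∣ ⟦ dual i ⟧ (u j) ∣             ≡⟨ proj₂ (some-dual-is-unit j) ⟩
      1                                ∎)

module BergmanPushForward
  {n k} (F : TropicalFan n) (π : ℤ^ n ⊸ ℤ^ k) (G : TropicalFan k)
  (push : IsPushForward π F G) (bergman : IsBergman G) where

  private
    module F = TropicalFan F
    module G = TropicalFan G
  open IsPushForward push
  open BergmanRays G bergman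

  term : G.Ray → F.Ray → ℕ
  term s r = F.ω r ℕ.* mult r s

  sum-term : ∀ s → ℕΣ.sum (term s) ≡ 1
  sum-term s = trans (sym (weight s)) (weight-1 s)

  over⇒mult>0 : ∀ {r s} → ⟦ π ⟧ (F.v r) ∈ray G.v s →
                0 ℕ.< mult r s × ⟦ π ⟧ (F.v r) ≗ mult r s · G.v s
  over⇒mult>0 {r} {s} p with mult-spec r s
  ... | inj₁ q       = q
  ... | inj₂ (_ , ¬p) = contradiction p ¬p

  over⇒term>0 : ∀ {r s} → ⟦ π ⟧ (F.v r) ∈ray G.v s → 0 ℕ.< term s r
  over⇒term>0 {r} p = ℕ.*-mono-≤ (F.ω>0 r) (proj₁ (over⇒mult>0 p))

  over⇒≗ : ∀ {r s} → ⟦ π ⟧ (F.v r) ∈ray G.v s → ⟦ π ⟧ (F.v r) ≗ G.v s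
  over⇒≗ {r} {s} p c = begin
    ⟦ π ⟧ (F.v r) c        ≡⟨ proj₂ (over⇒mult>0 p) c ⟩
    (mult r s · G.v s) c   ≡⟨ cong (λ m → (m · G.v s) c) mult≡1 ⟩
    (1 · G.v s) c          ≡⟨ 1·-identity (G.v s) c ⟩
    G.v s c                ∎
    where
    mult≡1 : mult r s ≡ 1
    mult≡1 = ℕ.m*n≡1⇒n≡1 (F.ω r) (mult r s) (ℕ.≤-antisym
      (subst (term s r ℕ.≤_) (sum-term s) (term≤sum (term s) r))
      (over⇒term>0 p))

  Over : Fin (suc k) → F.Ray → Set
  Over j r = ⟦ π ⟧ (F.v r) ≗ u j

  rayOf : Fin (suc k) → G.Ray
  rayOf j = proj₁ (u-is-ray j)

  rayOf≗u : ∀ j → G.v (rayOf j) ≗ u j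
  rayOf≗u j = ray≗u (proj₂ (u-is-ray j))

  Over⇒∈ray : ∀ {j r} → Over j r → ⟦ π ⟧ (F.v r) ∈ray G.v (rayOf j)
  Over⇒∈ray {j} o = ≗⇒∈ray λ c → trans (o c) (sym (rayOf≗u j c))

  Over-unique : ∀ {j r r′} → Over j r → Over j r′ → r ≡ r′
  Over-unique {j} o o′ = sum≤1⇒positive-unique (term (rayOf j))
    (ℕ.≤-reflexive (sum-term (rayOf j))) _ _
    (over⇒term>0 (Over⇒∈ray o)) (over⇒term>0 (Over⇒∈ray o′))

  lift : ∀ j → ∃[ r ] Over j r
  lift j with r , p ← ray-is-image (rayOf j) =
    r , λ c → trans (over⇒≗ p c) (rayOf≗u j c)

  fibre⇒Over : ∀ {r} → Fibre π F G r → ∃[ j ] Over j r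
  fibre⇒Over (s , p) with j , q ← ray-is-u s =
    j , λ c → trans (over⇒≗ p c) (ray≗u q c)

  image : ∀ r → ⟦ π ⟧ (F.v r) ≗ 0ᵛ ⊎ ∃[ j ] Over j r
  image r with all? (λ c → ⟦ π ⟧ (F.v r) c ℤ.≟ 0ℤ)
  ... | yes z = inj₁ z
  ... | no ¬z = inj₂ (fibre⇒Over (image-is-ray r ¬z))

  module _ (i : Fin k) where

    form : Dual n
    form = dual i ⊚ π

    data Value (r : F.Ray) : Set where
      one      : Over (suc i) r → ⟦ form ⟧ (F.v r) ≡ 1ℤ → Value r
      minusOne : Over zero r → ⟦ form ⟧ (F.v r) ≡ -1ℤ → Value r
      nought   : ⟦ form ⟧ (F.v r) ≡ 0ℤ → Value r

    value : ∀ r → Value r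
    value r with image r
    ... | inj₁ z          = nought (trans (dual-cong i z) (dual-0 i))
    ... | inj₂ (zero , o) = minusOne o (trans (dual-cong i o) (dual-u₀ i))
    ... | inj₂ (suc j , o) with j ≟ i
    ...   | yes refl = one o (trans (dual-cong i o) (dual-uᵢ i))
    ...   | no j≢i   =
      nought (trans (dual-cong i o) (trans (dual-basis i j) (unit-≢ j≢i)))

    positive-part : ∀ r → 0ℤ ⊔ ⟦ form ⟧ (F.v r) ≡ + mult r (rayOf (suc i))
    positive-part r with mult-spec r (rayOf (suc i))
    ... | inj₁ (_ , eq) = cong (0ℤ ⊔_) (begin
      ⟦ form ⟧ (F.v r)              ≡⟨ dual-cong i eq ⟩
      ⟦ dual i ⟧ (m · G.v s)        ≡⟨ dual-* i (+ m) (G.v s) ⟩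
      + m ℤ.* ⟦ dual i ⟧ (G.v s)    ≡⟨ cong (ℤ._*_ (+ m)) (dual-cong i (rayOf≗u (suc i))) ⟩
      + m ℤ.* ⟦ dual i ⟧ (u (suc i)) ≡⟨ cong (ℤ._*_ (+ m)) (dual-uᵢ i) ⟩
      + m ℤ.* 1ℤ                    ≡⟨ ℤ.*-identityʳ (+ m) ⟩
      + m                           ∎)
      where
      s = rayOf (suc i)
      m = mult r s
    ... | inj₂ (mult≡0 , ¬p) = trans nonpositive (cong +_ (sym mult≡0))
      where
      nonpositive : 0ℤ ⊔ ⟦ form ⟧ (F.v r) ≡ 0ℤ
      nonpositive with value r
      ... | one o _       = contradiction (Over⇒∈ray o) ¬p
      ... | minusOne _ eq = cong (0ℤ ⊔_) eq
      ... | nought eq     = cong (0ℤ ⊔_) eq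

    max-form≡1 : max[0, form ]· F ≡ 1ℤ
    max-form≡1 = begin
      ℤΣ.sum (λ r → + F.ω r ℤ.* (0ℤ ⊔ ⟦ form ⟧ (F.v r)))
        ≡⟨ ℤΣ.sum-cong-≗ (λ r → trans (cong (ℤ._*_ (+ F.ω r)) (positive-part r))
             (sym (ℤ.pos-* (F.ω r) _))) ⟩
      ℤΣ.sum (+_ ∘ term (rayOf (suc i)))
        ≡⟨ pos-sum (term (rayOf (suc i))) ⟩
      + ℕΣ.sum (term (rayOf (suc i)))
        ≡⟨ cong +_ (sum-term (rayOf (suc i))) ⟩
      1ℤ ∎

    lifts-form-gallery : ∀ {r₀ r} → Over zero r₀ → Over (suc i) r →
                         FormGallery F r₀ r
    lifts-form-gallery {r₀} {r} o₀ o = form , max-form≡1 , to , from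
      where
      to : Gallery F form ⊆ ｛ r₀ ｝ ∪ ｛ r ｝
      to {t} ∣l∣≡1 with value t
      ... | one o′ _      = inj₂ (Over-unique o o′)
      ... | minusOne o′ _ = inj₁ (Over-unique o₀ o′)
      ... | nought eq     = contradiction (trans (sym (cong ∣_∣ eq)) ∣l∣≡1) λ ()
      from : ｛ r₀ ｝ ∪ ｛ r ｝ ⊆ Gallery F form
      from (inj₁ refl) = cong ∣_∣ (trans (dual-cong i o₀) (dual-u₀ i))
      from (inj₂ refl) = cong ∣_∣ (trans (dual-cong i o) (dual-uᵢ i))

  r₀ : F.Ray
  r₀ = proj₁ (lift zero)

  fibre⊆class : Fibre π F G ⊆ GalleryClass F r₀
  fibre⊆class p with fibre⇒Over p
  ... | zero  , o = inj₁ (Over-unique (proj₂ (lift zero)) o)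
  ... | suc i , o = inj₂ (lifts-form-gallery i (proj₂ (lift zero)) o)

lemma3p14 : ∀ {n k} (F : TropicalFan n) → Spanning F →
    (π : ℤ^ n ⊸ ℤ^ k) (G : TropicalFan k) → IsPushForward π F G →
    IsBergman G →
    ∃[ r ] Fibre π F G ⊆ GalleryClass F r
lemma3p14 F _ π G push bergman = r₀ , fibre⊆class
  where open BergmanPushForward F π G push bergman
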